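{- Every word of length $78$ over the binary alphabet $\{a,b\}$ that contains neither $aaaa$ nor $bb$ as a factor contains an abelian $5$-power. This bound is tight: the word $$aaababababaaababababaaabaaabaaabaaababababaaabaaabaaabaaababababaaababababaaa$$ of length $77$ contains neither $aaaa$ nor $bb$ as a factor and does not contain an abelian $5$-power.
   Context: A factor of a word is a contiguous subword. A word contains an abelian $k$-power if it has a factor of the form $v_1v_2\cdots v_k$ where $v_1,\dots,v_k$ are non-empty words that are permutations (anagrams) of one another. -}

module Defs where

open import Data.List.Base using (List; []; _∷_; length; concat)
open import Data.List.Relation.Binary.Infix.Heterogeneous using (Infix)
open import Data.List.Relation.Binary.Permutation.Propositional using (_↭_)
open import Data.List.Relation.Unary.All using (All)
open import Data.List.Relation.Unary.AllPairs using (AllPairs)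
open import Data.Nat.Base using (ℕ)
open import Data.Product.Base using (∃-syntax; _×_)
open import Level using (Level)
open import Relation.Binary.PropositionalEquality using (_≡_; _≢_)

private
  variable
    ℓ : Level
    A : Set ℓ

infix 4 _IsFactorOf_

_IsFactorOf_ : List A → List A → Set _
u IsFactorOf w = Infix _≡_ u w

ContainsAbelianPower : ℕ → List A → Set _
ContainsAbelianPower k w =
  ∃[ vs ] length vs ≡ k
        × All (_≢ []) vs
        × AllPairs _↭_ vs
        × concat vs IsFactorOf w

data Letter : Set where
  a b : Letter

Word : Set
Word = List Letter

aaaa bb : Word
aaaa = a ∷ a ∷ a ∷ a ∷ []
bb   = b ∷ b ∷ []

extremalWord : Word
extremalWord =
  a ∷ a ∷ a ∷ b ∷ a ∷ b ∷ a ∷ b ∷ a ∷ b ∷ a ∷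
  a ∷ a ∷ b ∷ a ∷ b ∷ a ∷ b ∷ a ∷ b ∷ a ∷ a ∷
  a ∷ b ∷ a ∷ a ∷ a ∷ b ∷ a ∷ a ∷ a ∷ b ∷ a ∷
  a ∷ a ∷ b ∷ a ∷ b ∷ a ∷ b ∷ a ∷ b ∷ a ∷ a ∷
  a ∷ b ∷ a ∷ a ∷ a ∷ b ∷ a ∷ a ∷ a ∷ b ∷ a ∷
  a ∷ a ∷ b ∷ a ∷ b ∷ a ∷ b ∷ a ∷ b ∷ a ∷ a ∷
  a ∷ b ∷ a ∷ b ∷ a ∷ b ∷ a ∷ b ∷ a ∷ a ∷ a ∷ []

{-# OPTIONS --safe #-}
-- Grow words to the left: a word is dead as soon as it starts with aaaa, bb or
-- an abelian 5-power, and every word that extends a dead word on the left still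
-- has a forbidden factor.  The backtracking tree rooted at the empty word has
-- only a few thousand live nodes and none at depth 78, which the type checker
-- confirms by evaluation.  An abelian k-power at the start of u is determined by
-- the common length of its blocks, which makes the property decidable.
module Submission where

open import Defs
open import Data.List.Base
  using (List; []; _∷_; _++_; _ʳ++_; concat; drop; filter; length; replicate; reverse; take)
open import Data.List.Properties
  using (++-assoc; length-++; length-++-≤ˡ; length-reverse; reverse-involutive; take++drop≡id)
open import Data.List.Relation.Binary.Infix.Heterogeneous using (here; there)
open import Data.List.Relation.Binary.Infix.Heterogeneous.Properties using (infix?)
open import Data.List.Relation.Binary.Permutation.Propositional
  using (_↭_; ↭-refl; ↭-reflexive; ↭-sym; ↭-trans; prep)
open import Data.List.Relation.Binary.Permutation.Propositional.Properties
  using (¬x∷xs↭[]; filter-↭; shift; ↭-length)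
open import Data.List.Relation.Binary.Pointwise using (Pointwise-≡⇒≡; ≡⇒Pointwise-≡)
open import Data.List.Relation.Binary.Prefix.Heterogeneous as Prefix using (Prefix)
import Data.List.Relation.Binary.Prefix.Heterogeneous.Properties as Prefix
open import Data.List.Relation.Unary.All as All using (All; []; _∷_)
open import Data.List.Relation.Unary.AllPairs as AllPairs using (AllPairs; []; _∷_; allPairs?)
open import Data.Nat.Base using (ℕ; zero; suc; _+_; _*_; _<_; _/_; NonZero)
open import Data.Nat.DivMod using (/-monoˡ-≤; m*n/n≡m)
open import Data.Nat.Properties
  using (_≟_; *-comm; anyUpTo?; module ≤-Reasoning)
open import Data.Product.Base using (∃-syntax; _×_; _,_; <_,_>; uncurry)
open import Data.Sum.Base using (_⊎_; inj₁; inj₂; [_,_])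
open import Function.Base using (_∘_; flip; id)
open import Level using (Level)
open import Relation.Binary.Definitions using (DecidableEquality)
open import Relation.Binary.PropositionalEquality
  using (_≡_; _≢_; refl; sym; trans; cong; cong₂; subst)
open import Relation.Nullary
  using (¬_; Dec; contradiction; yes; no; from-yes; from-no; map′; _×-dec_; _⊎-dec_)
open import Relation.Unary using (Decidable; Pred; _⊆_)

private
  variable
    ℓ : Level
    A : Set ℓ

_≟ˡ_ : DecidableEquality Letter
a ≟ˡ a = yes refl
a ≟ˡ b = no λ ()
b ≟ˡ a = no λ ()
b ≟ˡ b = yes refl

count : Letter → Word → ℕ
count x u = length (filter (x ≟ˡ_) u)

count-↭ : ∀ (x : Letter) {u v} → u ↭ v → count x u ≡ count x v
count-↭ x p = ↭-length (filter-↭ (x ≟ˡ_) p)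

-- With only two letters, the pair of counts determines this sorted form, so anagrams can be
-- recognised by comparing two numbers instead of searching for a permutation.
↭-sorted : ∀ u → u ↭ replicate (count a u) a ++ replicate (count b u) b
↭-sorted []      = ↭-refl
↭-sorted (a ∷ u) = prep a (↭-sorted u)
↭-sorted (b ∷ u) = ↭-trans (prep b (↭-sorted u)) (↭-sym (shift b _ _))

count⇒↭ : ∀ u v → count b u ≡ count b v → count a u ≡ count a v → u ↭ v
count⇒↭ u v #b≡ #a≡ = ↭-trans (↭-sorted u)
  (↭-trans (↭-reflexive (cong₂ (λ m n → replicate m a ++ replicate n b) #a≡ #b≡))
           (↭-sym (↭-sorted v)))

_↭?_ : (u v : Word) → Dec (u ↭ v)
u ↭? v = map′ (uncurry (count⇒↭ u v)) < count-↭ b , count-↭ a >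
  ((count b u ≟ count b v) ×-dec (count a u ≟ count a v))

blocks : ℕ → ℕ → List A → List (List A)
blocks zero    m u = []
blocks (suc k) m u = take m u ∷ blocks k m (drop m u)

length-blocks : ∀ k m (u : List A) → length (blocks k m u) ≡ k
length-blocks zero    m u = refl
length-blocks (suc k) m u = cong suc (length-blocks k m (drop m u))

concat-blocks : ∀ k m (u : List A) → Prefix _≡_ (concat (blocks k m u)) u
concat-blocks zero    m u = Prefix.[]
concat-blocks (suc k) m u = subst (Prefix _≡_ _) (take++drop≡id m u)
  (Prefix.++⁺ (≡⇒Pointwise-≡ refl) (concat-blocks k m (drop m u)))

take-length-++ : ∀ (u : List A) {v} → take (length u) (u ++ v) ≡ u
take-length-++ []      = refl
take-length-++ (x ∷ u) = cong (x ∷_) (take-length-++ u)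

drop-length-++ : ∀ (u : List A) {v} → drop (length u) (u ++ v) ≡ v
drop-length-++ []      = refl
drop-length-++ (x ∷ u) = drop-length-++ u

-- Cutting at a fixed length undoes `concat`, so a power can be recovered from its number of blocks
-- and their common length, whatever follows it.
blocks-concat : ∀ {m} {vs : List (List A)} s → All (λ v → length v ≡ m) vs →
                blocks (length vs) m (concat vs ++ s) ≡ vs
blocks-concat                 s []           = refl
blocks-concat {vs = v ∷ vs} s (refl ∷ eqs)
  rewrite ++-assoc v (concat vs) s
        | take-length-++ v {concat vs ++ s}
        | drop-length-++ v {concat vs ++ s} = cong (v ∷_) (blocks-concat s eqs)

length-concat : ∀ {m} {vs : List (List A)} → All (λ v → length v ≡ m) vs →
                length (concat vs) ≡ length vs * m
length-concat                 []           = refl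
length-concat {vs = v ∷ vs} (refl ∷ eqs) =
  trans (length-++ v) (cong (length v +_) (length-concat eqs))

-- The block length is suc m, so no block can be empty.
StartsWithAbelianPower : (k : ℕ) .{{_ : NonZero k}} → List A → Set _
StartsWithAbelianPower k u =
  ∃[ m ] m < length u / k × AllPairs _↭_ (blocks k (suc m) u)

startsWithAbelianPower? : ∀ k .{{_ : NonZero k}} u → Dec (StartsWithAbelianPower {A = Letter} k u)
startsWithAbelianPower? k u =
  anyUpTo? (λ m → allPairs? _↭?_ (blocks k (suc m) u)) (length u / k)

-- Anagrams have equal lengths, so all blocks are as long as the first one. Since `k` of them fit
-- into `u`, that length is at most `length u / k`, which makes the search finite.
startsWithAbelianPower⁺ : ∀ k .{{_ : NonZero k}} {vs : List (List A)} {u} →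
  length vs ≡ k → All (_≢ []) vs → AllPairs _↭_ vs → Prefix _≡_ (concat vs) u →
  StartsWithAbelianPower k u
startsWithAbelianPower⁺ .(suc (length vs)) {[] ∷ vs} refl (≢[] ∷ _) _ _ =
  contradiction refl ≢[]
startsWithAbelianPower⁺ k {ws@((x ∷ v) ∷ vs)} refl _ ↭s@(↭v ∷ _) p
  with r Prefix.++ s ← Prefix.toView p
  with refl ← Pointwise-≡⇒≡ r
  -- The first block is `x ∷ v`, so the common length is `suc (length v)`.
  = length v , m<∣u∣/k , subst (AllPairs _↭_) (sym (blocks-concat s lengths)) ↭s
  where
  lengths : All (λ w → length w ≡ suc (length v)) ws
  lengths = refl ∷ All.map (sym ∘ ↭-length) ↭v

  m<∣u∣/k : length v < length (concat ws ++ s) / length ws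
  m<∣u∣/k = begin
    suc (length v)                         ≡⟨ m*n/n≡m (suc (length v)) (length ws) ⟨
    suc (length v) * length ws / length ws ≡⟨ cong (_/ length ws) (*-comm (suc (length v)) (length ws)) ⟩
    length ws * suc (length v) / length ws ≡⟨ cong (_/ length ws) (length-concat lengths) ⟨
    length (concat ws) / length ws         ≤⟨ /-monoˡ-≤ (length ws) (length-++-≤ˡ (concat ws)) ⟩
    length (concat ws ++ s) / length ws    ∎
    where open ≤-Reasoning

startsWithAbelianPower⁻ : ∀ k .{{_ : NonZero k}} (u : List A) →
  StartsWithAbelianPower k u → ContainsAbelianPower k u
-- An empty word leaves no case: the bound would read `m < 0`.
startsWithAbelianPower⁻ (suc k) (x ∷ u) (m , _ , ↭s) =
  blocks (suc k) (suc m) (x ∷ u) , length-blocks (suc k) (suc m) (x ∷ u) ,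
  -- The first block begins with `x`; the others are anagrams of it, hence non-empty too.
  (λ ()) ∷ All.map (λ { p refl → ¬x∷xs↭[] p }) (AllPairs.head ↭s) ,
  ↭s , here (concat-blocks (suc k) (suc m) (x ∷ u))

containsAbelianPower-∷ : ∀ {k x} {w : List A} → ContainsAbelianPower k w →
                         ContainsAbelianPower k (x ∷ w)
containsAbelianPower-∷ (vs , len , ≢[]s , ↭s , i) = vs , len , ≢[]s , ↭s , there i

-- A factor is a prefix of a suffix, so it is enough to test the start of each suffix in turn.
containsAbelianPower? : ∀ k .{{_ : NonZero k}} w → Dec (ContainsAbelianPower {A = Letter} k w)
containsAbelianPower? k w with startsWithAbelianPower? k w
... | yes p = yes (startsWithAbelianPower⁻ k w p)
containsAbelianPower? k [] | no ¬p = no λ where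
  (_ , len , ≢[]s , ↭s , here p) → ¬p (startsWithAbelianPower⁺ k len ≢[]s ↭s p)
containsAbelianPower? k (x ∷ w) | no ¬p = map′
  containsAbelianPower-∷
  (λ where
    (_  , len , ≢[]s , ↭s , here p)  → contradiction (startsWithAbelianPower⁺ k len ≢[]s ↭s p) ¬p
    (vs , len , ≢[]s , ↭s , there i) → vs , len , ≢[]s , ↭s , i)
  (containsAbelianPower? k w)

private
  variable
    p q : Level
    P : Pred Word p
    Q : Pred Word q

-- An inductive family rather than a recursive function: a type computed by
-- recursion on n unfolds to exponential size when types are compared at n = 78.
data Bar (P : Pred Word p) : ℕ → Pred Word p where
  now   : ∀ {n u} → P u → Bar P n u
  later : ∀ {n u} → Bar P n (a ∷ u) → Bar P n (b ∷ u) → Bar P (suc n) u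

-- The disjunction tests `P? u` first and is evaluated lazily, so nothing below a dead word is
-- explored.
bar? : Decidable P → ∀ n → Decidable (Bar P n)
bar? P? zero    u = map′ now (λ { (now Pu) → Pu }) (P? u)
bar? P? (suc n) u = map′
  [ now , uncurry later ]
  (λ { (now Pu) → inj₁ Pu ; (later p q) → inj₂ (p , q) })
  (P? u ⊎-dec (bar? P? n (a ∷ u) ×-dec bar? P? n (b ∷ u)))

module _ (P⊆Q : P ⊆ Q) (Q-∷ : ∀ {x u} → Q u → Q (x ∷ u)) where

  ʳ++-closed : ∀ v {u} → Q u → Q (v ʳ++ u)
  ʳ++-closed []      Qu = Qu
  ʳ++-closed (x ∷ v) Qu = ʳ++-closed v (Q-∷ Qu)

  -- The letters of `v` select a branch of the tree, because `_ʳ++_` pushes them to the front one by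
  -- one. Once the branch meets `P`, the remaining letters only extend the word to the left, which
  -- preserves `Q`.
  bar-ʳ++ : ∀ v {u} → Bar P (length v) u → Q (v ʳ++ u)
  bar-ʳ++ []      (now Pu)      = P⊆Q Pu
  bar-ʳ++ (x ∷ v) (now Pu)      = ʳ++-closed (x ∷ v) (P⊆Q Pu)
  bar-ʳ++ (a ∷ v) (later bar _) = bar-ʳ++ v bar
  bar-ʳ++ (b ∷ v) (later _ bar) = bar-ʳ++ v bar

  bar-[] : ∀ w → Bar P (length w) [] → Q w
  -- The tree builds `w` from its last letter, so the branch to follow is spelled by `reverse w`.
  bar-[] w bar = subst Q (reverse-involutive w)
    (bar-ʳ++ (reverse w) (subst (λ n → Bar P n []) (sym (length-reverse w)) bar))

-- Prefixes suffice at a node: a forbidden factor that starts further right was already a prefix at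
-- an ancestor.
StartsBadly : Pred Word _
StartsBadly u = Prefix _≡_ aaaa u ⊎ Prefix _≡_ bb u ⊎ StartsWithAbelianPower 5 u

startsBadly? : Decidable StartsBadly
startsBadly? u =
  Prefix.prefix? _≟ˡ_ aaaa u ⊎-dec Prefix.prefix? _≟ˡ_ bb u ⊎-dec startsWithAbelianPower? 5 u

IsBad : Pred Word _
IsBad w = aaaa IsFactorOf w ⊎ bb IsFactorOf w ⊎ ContainsAbelianPower 5 w

startsBadly⇒isBad : StartsBadly ⊆ IsBad
startsBadly⇒isBad     (inj₁ p)        = inj₁ (here p)
startsBadly⇒isBad     (inj₂ (inj₁ p)) = inj₂ (inj₁ (here p))
startsBadly⇒isBad {u} (inj₂ (inj₂ p)) = inj₂ (inj₂ (startsWithAbelianPower⁻ 5 u p))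

isBad-∷ : ∀ {x w} → IsBad w → IsBad (x ∷ w)
isBad-∷ (inj₁ i)        = inj₁ (there i)
isBad-∷ (inj₂ (inj₁ i)) = inj₂ (inj₁ (there i))
isBad-∷ (inj₂ (inj₂ c)) = inj₂ (inj₂ (containsAbelianPower-∷ c))

bar-78 : Bar StartsBadly 78 []
bar-78 = from-yes (bar? startsBadly? 78 [])

proposition4p3 : ((w : Word) → length w ≡ 78 →
    ¬ (aaaa IsFactorOf w) → ¬ (bb IsFactorOf w) →
    ContainsAbelianPower 5 w)
    × (length extremalWord ≡ 77
    × ¬ (aaaa IsFactorOf extremalWord)
    × ¬ (bb IsFactorOf extremalWord)
    × ¬ ContainsAbelianPower 5 extremalWord)
proposition4p3 =
  (λ w len ¬aaaa ¬bb →
    [ flip contradiction ¬aaaa , [ flip contradiction ¬bb , id ] ]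
      (bar-[] startsBadly⇒isBad isBad-∷ w
        (subst (λ n → Bar StartsBadly n []) (sym len) bar-78))) ,
  refl ,
  from-no (infix? _≟ˡ_ aaaa extremalWord) ,
  from-no (infix? _≟ˡ_ bb extremalWord) ,
  -- Decided by evaluation: each suffix admits at most 77 / 5 = 15 block lengths.
  from-no (containsAbelianPower? 5 extremalWord)
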